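{- Let $\lambda$ be a partition of $n$ and let $S$ be a filling of $\lambda$ with nonnegative integers that is semistandard (weakly increasing from left to right across rows and strictly increasing from bottom to top up columns). Then all elements of $B_\lambda^S=\{F_T^S : T\in\mathrm{SYT}(\lambda)\}$ are nonzero.
   Context: Young diagrams are in French notation (the first, largest part is the bottom row). $\mathrm{SYT}(\lambda)$ is the set of standard Young tableaux of shape $\lambda$ (entries $1,\dots,n$, increasing along rows and up columns). $\mathfrak S_n$ acts on $\mathbb{C}[x_1,\dots,x_n]$ by $\sigma x_i=x_{\sigma(i)}$. $\mathcal R(T),\mathcal C(T)\subseteq\mathfrak S_n$ are the subgroups preserving the set of entries of each row, respectively column, of $T$, and $\varepsilon_T=\sum_{\tau\in\mathcal C(T)}\sum_{\sigma\in\mathcal R(T)}(-1)^\tau\,\tau\sigma$. Put $\mathbf{x}_T^S=\prod_{b\in\lambda}x_{T(b)}^{S(b)}$ (over boxes $b$ of $\lambda$) and $F_T^S=\varepsilon_T\mathbf{x}_T^S\in\mathbb{C}[x_1,\dots,x_n]$. -}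

module Defs where

open import Algebra.Bundles using (CommutativeRing; Semiring)
open import Data.Bool.Base using (if_then_else_)
open import Data.Fin.Base as Fin using (Fin; zero; suc; toℕ)
open import Data.Fin.Permutation using (Permutation′; _⟨$⟩ʳ_; _⟨$⟩ˡ_; _∘ₚ_; insert)
  renaming (id to idₚ)
import Data.Fin.Properties as Fin
open import Data.List.Base as List
  using (List; []; _∷_; [_]; length; lookup; map; concatMap; cartesianProductWith; foldr; filter;
    allFin; _++_)
open import Data.List.Relation.Unary.All using (All)
open import Data.List.Relation.Unary.Linked using (Linked)
open import Data.Nat.Base as ℕ using (ℕ; zero; suc)
open import Data.Nat.ListAction using (sum)
import Data.Nat.Properties as ℕ
open import Data.Product.Base using (Σ; ∃; _×_; _,_)
open import Data.Vec.Base as Vec using (Vec)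
import Data.Vec.Properties as Vec
open import Function.Bundles using (_⇔_; mk⇔; Equivalence)
open import Function.Definitions using (Bijective)
open import Level using (Level)
open import Relation.Binary.Core using (Rel)
open import Relation.Binary.Definitions using (Decidable)
open import Relation.Binary.PropositionalEquality using (_≡_)
open import Relation.Nullary.Decidable using (Dec; does; map′; _×-dec_; _→-dec_)
import Relation.Unary as U

private variable
  c ℓ p : Level
  n : ℕ

------------------------------------------------------------------------
-- Partitions and tableaux

record Partition (n : ℕ) : Set where
  field
    parts      : List ℕ
    decreasing : Linked ℕ._≥_ parts
    positive   : All (0 ℕ.<_) parts
    total      : sum parts ≡ n

open Partition public

-- French notation: row 0 is the bottom row and has the largest length.
Box : Partition n → Set
Box μ = Σ (Fin (length (parts μ))) λ i → Fin (lookup (parts μ) i)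

row col : (μ : Partition n) → Box μ → ℕ
row μ (i , j) = toℕ i
col μ (i , j) = toℕ j

boxes : (μ : Partition n) → List (Box μ)
boxes μ = concatMap (λ i → map (i ,_) (allFin (lookup (parts μ) i)))
                    (allFin (length (parts μ)))

SameRow SameCol : (μ : Partition n) → Rel (Box μ) _
SameRow μ b b′ = row μ b ≡ row μ b′
SameCol μ b b′ = col μ b ≡ col μ b′

record Semistandard (μ : Partition n) (S : Box μ → ℕ) : Set where
  field
    row-weak   : ∀ b b′ → SameRow μ b b′ → col μ b ℕ.< col μ b′ → S b ℕ.≤ S b′
    col-strict : ∀ b b′ → SameCol μ b b′ → row μ b ℕ.< row μ b′ → S b ℕ.< S b′

-- The entries 1, …, n are represented by the elements of Fin n.
record SYT (μ : Partition n) : Set where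
  field
    entry      : Box μ → Fin n
    bijective  : Bijective _≡_ _≡_ entry
    row-strict : ∀ b b′ → SameRow μ b b′ → col μ b ℕ.< col μ b′ → entry b Fin.< entry b′
    col-strict : ∀ b b′ → SameCol μ b b′ → row μ b ℕ.< row μ b′ → entry b Fin.< entry b′

open SYT public using (entry)

------------------------------------------------------------------------
-- Row and column groups

-- σ A = A, for σ a permutation and A a subset.
Preserves : Permutation′ n → U.Pred (Fin n) p → Set p
Preserves σ A = ∀ x → A x ⇔ A (σ ⟨$⟩ʳ x)

-- For ~ the relation SameRow (SameCol), the set of entries in the row (column) of b.
EntriesOf : (μ : Partition n) → Rel (Box μ) ℓ → SYT μ → Box μ → U.Pred (Fin n) ℓ
EntriesOf μ _~_ T b x = ∃ λ b′ → (b ~ b′) × (entry T b′ ≡ x)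

InRowGroup InColGroup : (μ : Partition n) → SYT μ → U.Pred (Permutation′ n) _
InRowGroup μ T σ = ∀ b → Preserves σ (EntriesOf μ (SameRow μ) T b)
InColGroup μ T τ = ∀ b → Preserves τ (EntriesOf μ (SameCol μ) T b)

private
  preserves? : (σ : Permutation′ n) {A : U.Pred (Fin n) p} → U.Decidable A → Dec (Preserves σ A)
  preserves? σ A? = Fin.all? λ x →
    map′ (λ (f , g) → mk⇔ f g) (λ e → Equivalence.to e , Equivalence.from e)
         ((A? x →-dec A? (σ ⟨$⟩ʳ x)) ×-dec (A? (σ ⟨$⟩ʳ x) →-dec A? x))

  allBoxes? : (μ : Partition n) {P : U.Pred (Box μ) p} → U.Decidable P → Dec (∀ b → P b)
  allBoxes? μ P? = map′ (λ f (i , j) → f i j) (λ f i j → f (i , j))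
    (Fin.all? λ i → Fin.all? λ j → P? (i , j))

  anyBox? : (μ : Partition n) {P : U.Pred (Box μ) p} → U.Decidable P → Dec (∃ P)
  anyBox? μ P? = map′ (λ (i , j , q) → (i , j) , q) (λ ((i , j) , q) → i , j , q)
    (Fin.any? λ i → Fin.any? λ j → P? (i , j))

  group? : (μ : Partition n) {_~_ : Rel (Box μ) ℓ} → Decidable _~_ → (T : SYT μ) →
           (σ : Permutation′ n) → Dec (∀ b → Preserves σ (EntriesOf μ _~_ T b))
  group? μ _~?_ T σ = allBoxes? μ λ b → preserves? σ λ x →
    anyBox? μ λ b′ → (b ~? b′) ×-dec (entry T b′ Fin.≟ x)

inRowGroup? : (μ : Partition n) (T : SYT μ) → U.Decidable (InRowGroup μ T)
inRowGroup? μ = group? μ (λ b b′ → row μ b ℕ.≟ row μ b′)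

inColGroup? : (μ : Partition n) (T : SYT μ) → U.Decidable (InColGroup μ T)
inColGroup? μ = group? μ (λ b b′ → col μ b ℕ.≟ col μ b′)

-- Every permutation of Fin n occurs exactly once (up to pointwise equality):
-- insert zero j π sends zero to j and acts as π on the remaining elements.
permutations : (n : ℕ) → List (Permutation′ n)
permutations zero    = [ idₚ ]
permutations (suc n) = cartesianProductWith (insert zero) (allFin (suc n)) (permutations n)

rowGroup colGroup : (μ : Partition n) → SYT μ → List (Permutation′ n)
rowGroup {n} μ T = filter (inRowGroup? μ T) (permutations n)
colGroup {n} μ T = filter (inColGroup? μ T) (permutations n)

inversions : Permutation′ n → ℕ
inversions {n} τ = length (filter inversion? (List.cartesianProduct (allFin n) (allFin n)))
  where
  inversion? : U.Decidable λ ((i , j) : Fin n × Fin n) →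
               (i Fin.< j) × (τ ⟨$⟩ʳ j Fin.< τ ⟨$⟩ʳ i)
  inversion? (i , j) = (i Fin.<? j) ×-dec (τ ⟨$⟩ʳ j Fin.<? τ ⟨$⟩ʳ i)

------------------------------------------------------------------------
-- Polynomials

module _ (R : CommutativeRing c ℓ) where
  open CommutativeRing R
  open import Algebra.Definitions.RawSemiring (Semiring.rawSemiring semiring) using (_^_)
    renaming (_×_ to _×ᴿ_)

  CharacteristicZero : Set ℓ
  CharacteristicZero = ∀ k → k ×ᴿ 1# ≈ 0# → k ≡ 0

  sign : Permutation′ n → Carrier
  sign τ = (- 1#) ^ inversions τ

-- The polynomial ring R[x₁,…,xₙ]. The library has no complex numbers, so ℂ is
-- replaced by an arbitrary commutative ring R, assumed to satisfy CharacteristicZero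
-- where needed; ℂ is one such ring.
module Polynomials (R : CommutativeRing c ℓ) (n : ℕ) where
  open CommutativeRing R

  Monomial : Set
  Monomial = Vec ℕ n

  -- A finite formal sum of terms r x^α, possibly with repeated α.
  Poly : Set c
  Poly = List (Carrier × Monomial)

  coeff : Poly → Monomial → Carrier
  coeff []            β = 0#
  coeff ((r , α) ∷ f) β = (if does (Vec.≡-dec ℕ._≟_ α β) then r else 0#) + coeff f β

  infix 4 _≈ₚ_
  infixl 7 _*ₚ_ _•_
  infixl 6 _+ₚ_
  infixr 8 _^ₚ_

  _≈ₚ_ : Rel Poly ℓ
  f ≈ₚ g = ∀ β → coeff f β ≈ coeff g β

  0ₚ 1ₚ : Poly
  0ₚ = []
  1ₚ = [ 1# , Vec.replicate n 0 ]

  X : Fin n → Poly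
  X i = [ 1# , Vec.replicate n 0 Vec.[ i ]≔ 1 ]

  _+ₚ_ _*ₚ_ : Poly → Poly → Poly
  _+ₚ_ = _++_
  _*ₚ_ = cartesianProductWith λ (r , α) (s , β) → r * s , Vec.zipWith ℕ._+_ α β

  _•_ : Carrier → Poly → Poly
  r • f = map (λ (s , α) → r * s , α) f

  _^ₚ_ : Poly → ℕ → Poly
  f ^ₚ zero  = 1ₚ
  f ^ₚ suc k = f *ₚ f ^ₚ k

  sumₚ productₚ : List Poly → Poly
  sumₚ     = foldr _+ₚ_ 0ₚ
  productₚ = foldr _*ₚ_ 1ₚ

  -- σ xᵢ = x_{σ(i)}: the exponent of xⱼ in σ x^α is that of x_{σ⁻¹(j)} in x^α.
  act : Permutation′ n → Poly → Poly
  act σ = map λ (r , α) → r , Vec.tabulate λ j → Vec.lookup α (σ ⟨$⟩ˡ j)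

  -- Formal sums of terms r σ.
  GroupAlgebra : Set c
  GroupAlgebra = List (Carrier × Permutation′ n)

  infixr 7 _▷_
  _▷_ : GroupAlgebra → Poly → Poly
  u ▷ f = sumₚ (map (λ (r , σ) → r • act σ f) u)

  module _ (μ : Partition n) where

    -- The library's σ ∘ₚ τ applies σ first, so it is the product τσ.
    ε : SYT μ → GroupAlgebra
    ε T = cartesianProductWith (λ τ σ → sign R τ , σ ∘ₚ τ) (colGroup μ T) (rowGroup μ T)

    monomial : SYT μ → (Box μ → ℕ) → Poly
    monomial T S = productₚ (map (λ b → X (entry T b) ^ₚ S b) (boxes μ))

    F : SYT μ → (Box μ → ℕ) → Poly
    F T S = ε T ▷ monomial T S

    B : (Box μ → ℕ) → U.Pred Poly ℓ
    B S f = ∃ λ T → f ≈ₚ F T S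

{-# OPTIONS --safe #-}
module Submission where

-- Let a(x) be the entry of S in the box that contains x in T, so that the
-- monomial x_T^S has exponent vector a.  The proof shows that its coefficient
-- in F_T^S is a positive integer.
--
-- A term sgn(τ) τσ of ε_T contributes to this coefficient exactly when τσ
-- fixes x_T^S, that is, when a ∘ σ⁻¹ = a ∘ τ.  In that case τ is the identity
-- (column-part-trivial).  Indeed, suppose that τ fixes all rows below row k.
-- Then τ sends each x in row k to the same or a higher box of its column, so
-- a(τ x) ≥ a(x) because columns of S increase.  The sums of a(τ x) = a(σ⁻¹ x)
-- and of a(x) over row k agree, because σ permutes that row.  Hence
-- a(τ x) = a(x) for all x in row k, and strictness in columns forces τ x = x.
--
-- So every contributing term has sign +1 and the coefficient is the number of
-- contributing terms (coeff-stable).  The identity contributes, so this number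
-- is not 0, and neither is its image in a ring of characteristic zero.

open import Defs
open import Level using (Level)
open import Algebra.Bundles using (CommutativeRing)
open import Data.Nat.Base using (ℕ)
open import Relation.Nullary.Negation using (¬_)

open import Algebra.Bundles using (Semiring)
open import Data.Bool.Base using (if_then_else_)
open import Data.Fin.Base as Fin using (Fin; zero; suc)
open import Data.Fin.Permutation as Perm
  using (Permutation′; _⟨$⟩ʳ_; _⟨$⟩ˡ_; _∘ₚ_; insert; insert-punchIn)
  renaming (id to idₚ)
import Data.Fin.Properties as Fin
open import Data.List.Base as List
  using (List; []; _∷_; [_]; map; allFin; length; lookup; cartesianProduct)
import Data.List.Properties as List
open import Data.List.Membership.Propositional using (_∈_)
open import Data.List.Membership.Propositional.Properties
  using (∈-cartesianProductWith⁺; ∈-cartesianProductWith⁻; ∈-filter⁺; ∈-filter⁻;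
         ∈-concat⁺′; ∈-map⁺; ∈-map⁻; ∈-allFin)
open import Data.List.Relation.Unary.All as All using (All; []; _∷_)
import Data.List.Relation.Unary.All.Properties as All
open import Data.List.Relation.Unary.AllPairs as AllPairs using (_∷_)
import Data.List.Relation.Unary.AllPairs.Properties as AllPairs
open import Data.List.Relation.Unary.Any using (here; there)
open import Data.List.Relation.Unary.Unique.Propositional using (Unique)
import Data.List.Relation.Unary.Unique.Propositional.Properties as Unique
open import Data.Nat.Base as ℕ using (zero; suc; _<_; _≤_; z≤n; _+_; _*_)
open import Data.Nat.Induction using (<-rec)
open import Data.Nat.ListAction using (sum)
import Data.Nat.Properties as ℕ
open import Data.Product.Base using (∃; ∃₂; _×_; _,_; proj₁; proj₂)
open import Data.Sum.Base using (inj₁; inj₂)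
open import Data.Vec.Base as Vec using ()
import Data.Vec.Properties as Vec
open import Function.Base using (_∘_)
open import Function.Bundles using (mk⇔; Equivalence)
open import Relation.Binary.PropositionalEquality
  using (_≡_; _≢_; _≗_; refl; sym; trans; cong; cong₂; subst; subst₂; module ≡-Reasoning)
open import Relation.Nullary.Decidable using (does; yes; no)
open import Relation.Nullary.Negation using (contradiction)
open import Algebra.Properties.CommutativeMonoid.Sum ℕ.+-0-commutativeMonoid
  using (sum-permute; sum-cong-≗)
  renaming (sum to ∑)

private variable
  n : ℕ

-- Sums of natural numbers

∑-mono : {f g : Fin n → ℕ} → (∀ x → f x ≤ g x) → ∑ f ≤ ∑ g
∑-mono {zero}  f≤g = z≤n
∑-mono {suc n} f≤g = ℕ.+-mono-≤ (f≤g zero) (∑-mono (f≤g ∘ suc))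

∑-mono-equality : {f g : Fin n → ℕ} → (∀ x → f x ≤ g x) → ∑ f ≡ ∑ g → f ≗ g
∑-mono-equality {suc n} {f} {g} f≤g eq = λ where
    zero    → head-eq
    (suc x) → ∑-mono-equality (f≤g ∘ suc) tail-eq x
  where
  head-eq : f zero ≡ g zero
  head-eq with ℕ.m≤n⇒m<n∨m≡n (f≤g zero)
  ... | inj₂ f≡g = f≡g
  ... | inj₁ f<g =
    contradiction eq (ℕ.<⇒≢ (ℕ.+-mono-<-≤ f<g (∑-mono (f≤g ∘ suc))))
  tail-eq : ∑ (f ∘ suc) ≡ ∑ (g ∘ suc)
  tail-eq = ℕ.+-cancelˡ-≡ (f zero) _ _ (trans eq (cong (_+ ∑ (g ∘ suc)) (sym head-eq)))

sum-zero : {A : Set} (f : A → ℕ) {xs : List A} → All (λ y → f y ≡ 0) xs → sum (map f xs) ≡ 0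
sum-zero f []         = refl
sum-zero f (eq ∷ eqs) = cong₂ _+_ eq (sum-zero f eqs)

sum-single : {A : Set} (f : A → ℕ) {xs : List A} {x : A} → Unique xs → x ∈ xs →
             (∀ {y} → x ≢ y → f y ≡ 0) → sum (map f xs) ≡ f x
sum-single f {_ ∷ xs} (x∉xs ∷ _) (here refl) zero-off =
  trans (cong (f _ +_) (sum-zero f (All.map zero-off x∉xs))) (ℕ.+-identityʳ _)
sum-single f (y∉xs ∷ u) (there x∈xs) zero-off =
  cong₂ _+_ (zero-off λ x≡y → All.lookup y∉xs x∈xs (sym x≡y)) (sum-single f u x∈xs zero-off)

-- Row and column permutations with the same effect on a column-strict filling

-- Here r x and c x are the row and column of the box that contains x, and a x
-- is the number that the filling puts in this box.
column-part-trivial :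
  (r c a : Fin n → ℕ) →
  (∀ {x y} → r x ≡ r y → c x ≡ c y → x ≡ y) →
  (∀ {x y} → c x ≡ c y → r x < r y → a x < a y) →
  (σ τ : Permutation′ n) →
  (∀ x → r (σ ⟨$⟩ʳ x) ≡ r x) →
  (∀ x → c (τ ⟨$⟩ʳ x) ≡ c x) →
  (∀ x → a (σ ⟨$⟩ˡ x) ≡ a (τ ⟨$⟩ʳ x)) →
  ∀ x → τ ⟨$⟩ʳ x ≡ x
column-part-trivial {n} r c a box-injective a-strict σ τ σ-row τ-col same x =
  <-rec (λ k → ∀ x → r x ≡ k → τ ⟨$⟩ʳ x ≡ x) Row.row-fixed (r x) x refl
  where
  -- The value v in row i, restricted to row k and extended by zero.
  keep : ℕ → ℕ → ℕ → ℕ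
  keep k i v with i ℕ.≟ k
  ... | yes _ = v
  ... | no  _ = 0

  onRow : ℕ → (Fin n → ℕ) → Fin n → ℕ
  onRow k f x = keep k (r x) (f x)

  onRow-σ : ∀ k → onRow k a ∘ (σ ⟨$⟩ˡ_) ≗ onRow k (a ∘ (τ ⟨$⟩ʳ_))
  onRow-σ k x = cong₂ (keep k)
    (trans (sym (σ-row (σ ⟨$⟩ˡ x))) (cong r (Perm.inverseʳ σ))) (same x)

  row-sums : ∀ k → ∑ (onRow k a) ≡ ∑ (onRow k (a ∘ (τ ⟨$⟩ʳ_)))
  row-sums k = trans (sum-permute (onRow k a) (Perm.flip σ)) (sum-cong-≗ (onRow-σ k))

  module Row (k : ℕ) (below : ∀ {j} → j < k → ∀ x → r x ≡ j → τ ⟨$⟩ʳ x ≡ x) where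

    -- If τ moved x to a lower row, it would fix τ x, hence also x.
    not-lower : ∀ x → r x ≡ k → r x ≤ r (τ ⟨$⟩ʳ x)
    not-lower x refl with r x ℕ.≤? r (τ ⟨$⟩ʳ x)
    ... | yes up  = up
    ... | no  ¬up = contradiction (ℕ.≤-reflexive (cong r (sym fixed))) ¬up
      where
      fixed : τ ⟨$⟩ʳ x ≡ x
      fixed = trans (sym (Perm.inverseˡ τ))
        (trans (cong (τ ⟨$⟩ˡ_) (below (ℕ.≰⇒> ¬up) _ refl)) (Perm.inverseˡ τ))

    weight-increases : ∀ x → r x ≡ k → a x ≤ a (τ ⟨$⟩ʳ x)
    weight-increases x rx≡k with ℕ.m≤n⇒m<n∨m≡n (not-lower x rx≡k)
    ... | inj₁ higher   = ℕ.<⇒≤ (a-strict (sym (τ-col x)) higher)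
    ... | inj₂ same-row =
      ℕ.≤-reflexive (cong a (box-injective same-row (sym (τ-col x))))

    onRow-increases : ∀ x → onRow k a x ≤ onRow k (a ∘ (τ ⟨$⟩ʳ_)) x
    onRow-increases x with r x ℕ.≟ k
    ... | yes rx≡k = weight-increases x rx≡k
    ... | no  _    = z≤n

    weight-kept : ∀ x → r x ≡ k → a x ≡ a (τ ⟨$⟩ʳ x)
    weight-kept x rx≡k
      with r x ℕ.≟ k | ∑-mono-equality onRow-increases (row-sums k) x
    ... | yes _    | eq = eq
    ... | no rx≢k  | _  = contradiction rx≡k rx≢k

    row-fixed : ∀ x → r x ≡ k → τ ⟨$⟩ʳ x ≡ x
    row-fixed x rx≡k with ℕ.m≤n⇒m<n∨m≡n (not-lower x rx≡k)
    ... | inj₂ same-row = box-injective (sym same-row) (τ-col x)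
    ... | inj₁ higher   =
      contradiction (weight-kept x rx≡k) (ℕ.<⇒≢ (a-strict (sym (τ-col x)) higher))

-- The identity permutation

-- The identity is described pointwise, because a permutation carries proofs
-- that need not agree with those of idₚ.
identity-listed : ∀ n → ∃ λ π → (π ∈ permutations n) × (∀ x → π ⟨$⟩ʳ x ≡ x)
identity-listed zero    = idₚ , here refl , λ ()
identity-listed (suc n) with identity-listed n
... | π , π∈ , π-id =
  insert zero zero π ,
  ∈-cartesianProductWith⁺ (insert zero) (∈-allFin zero) π∈ ,
  λ where
    zero    → refl
    (suc x) → trans (insert-punchIn zero zero π x) (cong suc (π-id x))

inverse-identity : (π : Permutation′ n) → (∀ x → π ⟨$⟩ʳ x ≡ x) → ∀ x → π ⟨$⟩ˡ x ≡ x
inverse-identity π π-id x = trans (cong (π ⟨$⟩ˡ_) (sym (π-id x))) (Perm.inverseˡ π)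

identity-inversions : (π : Permutation′ n) → (∀ x → π ⟨$⟩ʳ x ≡ x) → inversions π ≡ 0
identity-inversions {n} π π-id = cong length (List.filter-none _ (All.universal
  (λ (i , j) (i<j , πj<πi) → Fin.<-asym i<j (subst₂ Fin._<_ (π-id j) (π-id i) πj<πi))
  (cartesianProduct (allFin n) (allFin n))))

-- Boxes and entries

box-≡ : (μ : Partition n) {b b′ : Box μ} → SameRow μ b b′ → SameCol μ b b′ → b ≡ b′
box-≡ μ {i , j} {i′ , j′} same-row same-col with Fin.toℕ-injective same-row
... | refl = cong (i ,_) (Fin.toℕ-injective same-col)

boxes-unique : (μ : Partition n) → Unique (boxes μ)
boxes-unique μ = Unique.concat⁺
  (All.map⁺ (All.universal
    (λ i → Unique.map⁺ (λ where refl → refl) (Unique.allFin⁺ (lookup (parts μ) i))) _))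
  (AllPairs.map⁺ (AllPairs.map disjoint (Unique.allFin⁺ (length (parts μ)))))
  where
  disjoint : ∀ {i i′} → i ≢ i′ → ∀ {b} → ¬ ((b ∈ map (i ,_) (allFin _)) ×
                                              (b ∈ map (i′ ,_) (allFin _)))
  disjoint {i} {i′} i≢i′ (b∈i , b∈i′) with ∈-map⁻ (i ,_) b∈i | ∈-map⁻ (i′ ,_) b∈i′
  ... | _ , _ , refl | _ , _ , refl = i≢i′ refl

boxes-complete : (μ : Partition n) (b : Box μ) → b ∈ boxes μ
boxes-complete μ (i , j) =
  ∈-concat⁺′ (∈-map⁺ (i ,_) (∈-allFin j)) (∈-map⁺ _ (∈-allFin i))

module _ (μ : Partition n) (T : SYT μ) where

  entry-injective : ∀ {b b′} → entry T b ≡ entry T b′ → b ≡ b′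
  entry-injective = proj₁ (SYT.bijective T)

  -- The box of T that contains x.
  boxOf : Fin n → Box μ
  boxOf x = proj₁ (proj₂ (SYT.bijective T) x)

  entry-boxOf : ∀ x → entry T (boxOf x) ≡ x
  entry-boxOf x = proj₂ (proj₂ (SYT.bijective T) x) refl

  boxOf-entry : ∀ b → boxOf (entry T b) ≡ b
  boxOf-entry b = entry-injective (entry-boxOf (entry T b))

  boxOf-injective : ∀ {x y} → boxOf x ≡ boxOf y → x ≡ y
  boxOf-injective eq = trans (sym (entry-boxOf _)) (trans (cong (entry T) eq) (entry-boxOf _))

  -- For _~_ the relation SameRow (SameCol), a permutation in the row (column)
  -- group moves every entry within its row (column).
  group-stays : {_~_ : Box μ → Box μ → Set} → (∀ {b} → b ~ b) → (σ : Permutation′ n) →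
                (∀ b → Preserves σ (EntriesOf μ _~_ T b)) →
                ∀ x → boxOf x ~ boxOf (σ ⟨$⟩ʳ x)
  group-stays {_~_} ~-refl σ preserves x
    with Equivalence.to (preserves (boxOf x) x) (boxOf x , ~-refl , entry-boxOf x)
  ... | b , x~b , eq = subst (boxOf x ~_) (trans (sym (boxOf-entry b)) (cong boxOf eq)) x~b

  rowGroup-stays : ∀ {σ} → σ ∈ rowGroup μ T → ∀ x → SameRow μ (boxOf x) (boxOf (σ ⟨$⟩ʳ x))
  rowGroup-stays {σ} σ∈ = group-stays {_~_ = SameRow μ} refl σ
    (proj₂ (∈-filter⁻ {P = InRowGroup μ T} (inRowGroup? μ T) {xs = permutations n} σ∈))

  colGroup-stays : ∀ {τ} → τ ∈ colGroup μ T → ∀ x → SameCol μ (boxOf x) (boxOf (τ ⟨$⟩ʳ x))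
  colGroup-stays {τ} τ∈ = group-stays {_~_ = SameCol μ} refl τ
    (proj₂ (∈-filter⁻ {P = InColGroup μ T} (inColGroup? μ T) {xs = permutations n} τ∈))

  identity-preserves : {A : Fin n → Set} (π : Permutation′ n) → (∀ x → π ⟨$⟩ʳ x ≡ x) →
                       Preserves π A
  identity-preserves {A} π π-id x = mk⇔ (subst A (sym (π-id x))) (subst A (π-id x))

-- Coefficients

module _ {c ℓ : Level} (K : CommutativeRing c ℓ) (n : ℕ) where
  open CommutativeRing K
    using (_≈_; 1#; +-cong; +-identityˡ; semiring; -_)
    renaming (_*_ to _*ᴷ_; refl to ≈-refl; sym to ≈-sym; trans to ≈-trans;
              *-cong to *ᴷ-cong; *-identityˡ to *ᴷ-identityˡ; reflexive to ≈-reflexive)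
  open import Algebra.Definitions.RawSemiring (Semiring.rawSemiring semiring)
    using (_^_) renaming (_×_ to _×ᴷ_)
  open Polynomials K n

  product-of-ones : ∀ {r s} → r ≈ 1# → s ≈ 1# → r *ᴷ s ≈ 1#
  product-of-ones r≈1 s≈1 = ≈-trans (*ᴷ-cong r≈1 s≈1) (*ᴷ-identityˡ 1#)

  sign-identity : (τ : Permutation′ n) → (∀ x → τ ⟨$⟩ʳ x ≡ x) → sign K τ ≈ 1#
  sign-identity τ τ-id = ≈-reflexive (cong ((- 1#) ^_) (identity-inversions τ τ-id))

  -- The exponent of x_j in x_i.
  δ : Fin n → Fin n → ℕ
  δ i j = if does (i Fin.≟ j) then 1 else 0

  δ-diagonal : ∀ i → δ i i ≡ 1
  δ-diagonal i with i Fin.≟ i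
  ... | yes _  = refl
  ... | no i≢i = contradiction refl i≢i

  δ-off-diagonal : ∀ {i j} → i ≢ j → δ i j ≡ 0
  δ-off-diagonal {i} {j} i≢j with i Fin.≟ j
  ... | yes i≡j = contradiction i≡j i≢j
  ... | no _    = refl

  -- The formal sum f is a single term whose coefficient equals 1 and whose
  -- exponents are given by e.
  IsMonomial : Poly → (Fin n → ℕ) → Set _
  IsMonomial f e = ∃₂ λ r α → (f ≡ [ r , α ]) × (r ≈ 1#) × (Vec.lookup α ≗ e)

  1ₚ-isMonomial : IsMonomial 1ₚ (λ _ → 0)
  1ₚ-isMonomial = _ , _ , refl , ≈-refl , λ j → Vec.lookup-replicate j 0

  X-isMonomial : ∀ i → IsMonomial (X i) (δ i)
  X-isMonomial i = _ , _ , refl , ≈-refl , exponent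
    where
    exponent : Vec.lookup (Vec.replicate n 0 Vec.[ i ]≔ 1) ≗ δ i
    exponent j with i Fin.≟ j
    ... | yes refl = Vec.lookup∘update i (Vec.replicate n 0) 1
    ... | no  i≢j  = trans (Vec.lookup∘update′ (i≢j ∘ sym) (Vec.replicate n 0) 1)
                           (Vec.lookup-replicate j 0)

  *ₚ-isMonomial : ∀ {f g d e} → IsMonomial f d → IsMonomial g e →
                  IsMonomial (f *ₚ g) (λ j → d j + e j)
  *ₚ-isMonomial (_ , α , refl , r≈1 , α≗) (_ , β , refl , s≈1 , β≗) =
    _ , _ , refl , product-of-ones r≈1 s≈1 ,
    λ j → trans (Vec.lookup-zipWith _+_ j α β) (cong₂ _+_ (α≗ j) (β≗ j))

  ^ₚ-isMonomial : ∀ {f e} → IsMonomial f e → ∀ k → IsMonomial (f ^ₚ k) (λ j → k * e j)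
  ^ₚ-isMonomial fm zero    = 1ₚ-isMonomial
  ^ₚ-isMonomial fm (suc k) = *ₚ-isMonomial fm (^ₚ-isMonomial fm k)

  productₚ-isMonomial : {A : Set} {f : A → Poly} {e : A → Fin n → ℕ} →
                        (∀ y → IsMonomial (f y) (e y)) → (ys : List A) →
                        IsMonomial (productₚ (map f ys)) (λ j → sum (map (λ y → e y j) ys))
  productₚ-isMonomial fm []       = 1ₚ-isMonomial
  productₚ-isMonomial fm (y ∷ ys) = *ₚ-isMonomial (fm y) (productₚ-isMonomial fm ys)

  monomial-isMonomial : (μ : Partition n) (T : SYT μ) (S : Box μ → ℕ) →
                        IsMonomial (monomial μ T S) (S ∘ boxOf μ T)
  monomial-isMonomial μ T S
    with productₚ-isMonomial (λ b → ^ₚ-isMonomial (X-isMonomial (entry T b)) (S b)) (boxes μ)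
  ... | r , α , eq , r≈1 , α≗ = r , α , eq , r≈1 , λ j → trans (α≗ j) (exponent j)
    where
    exponent : ∀ j → sum (map (λ b → S b * δ (entry T b) j) (boxes μ)) ≡ S (boxOf μ T j)
    exponent j = begin
      sum (map (λ b → S b * δ (entry T b) j) (boxes μ))
        ≡⟨ sum-single _ (boxes-unique μ) (boxes-complete μ (boxOf μ T j)) zero-off ⟩
      S (boxOf μ T j) * δ (entry T (boxOf μ T j)) j
        ≡⟨ cong (λ i → S (boxOf μ T j) * δ i j) (entry-boxOf μ T j) ⟩
      S (boxOf μ T j) * δ j j
        ≡⟨ cong (S (boxOf μ T j) *_) (δ-diagonal j) ⟩
      S (boxOf μ T j) * 1
        ≡⟨ ℕ.*-identityʳ _ ⟩
      S (boxOf μ T j) ∎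
      where
      open ≡-Reasoning
      zero-off : ∀ {b} → boxOf μ T j ≢ b → S b * δ (entry T b) j ≡ 0
      zero-off {b} ≢b = trans
        (cong (S b *_) (δ-off-diagonal λ eq → ≢b (trans (cong (boxOf μ T) (sym eq))
                                                        (boxOf-entry μ T b))))
        (ℕ.*-zeroʳ (S b))

  -- The exponent vector of σ x^α.
  permute : Permutation′ n → Monomial → Monomial
  permute σ α = Vec.tabulate λ j → Vec.lookup α (σ ⟨$⟩ˡ j)

  -- σ x^α = x^α, stated for each exponent.
  Fixes : Permutation′ n → Monomial → Set
  Fixes σ α = ∀ j → Vec.lookup α (σ ⟨$⟩ˡ j) ≡ Vec.lookup α j

  fixes⇒permute≡ : ∀ σ α → Fixes σ α → permute σ α ≡ α
  fixes⇒permute≡ σ α fixes = trans (Vec.tabulate-cong fixes) (Vec.tabulate∘lookup α)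

  permute≡⇒fixes : ∀ σ α → permute σ α ≡ α → Fixes σ α
  permute≡⇒fixes σ α eq j =
    trans (sym (Vec.lookup∘tabulate _ j)) (cong (λ β → Vec.lookup β j) eq)

  -- If all terms s σ of u with σ x^α = x^α have s = 1, then the coefficient of
  -- x^α in u (r x^α), where r = 1, is the number of these terms.
  coeff-stable : ∀ {r α} → r ≈ 1# → (u : GroupAlgebra) →
                 (∀ {s σ} → (s , σ) ∈ u → Fixes σ α → s ≈ 1#) →
                 ∃ λ k → (coeff (u ▷ [ r , α ]) α ≈ k ×ᴷ 1#) ×
                         (∀ {s σ} → (s , σ) ∈ u → Fixes σ α → k ≢ 0)
  coeff-stable r≈1 [] coeff-1 = 0 , ≈-refl , λ ()
  coeff-stable {r} {α} r≈1 ((s , σ) ∷ u) coeff-1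
    with coeff-stable r≈1 u (coeff-1 ∘ there) | Vec.≡-dec ℕ._≟_ (permute σ α) α
  ... | k , eq , _       | yes stable =
    suc k ,
    +-cong (product-of-ones (coeff-1 (here refl) (permute≡⇒fixes σ α stable)) r≈1) eq ,
    λ _ _ ()
  ... | k , eq , nonzero | no unstable =
    k , ≈-trans (+-identityˡ _) eq , λ where
      (here refl) fixes → contradiction (fixes⇒permute≡ σ α fixes) unstable
      (there ∈u)  fixes → nonzero ∈u fixes

  -- The vector α below is the exponent vector of x_T^S.
  F-nonzero : CharacteristicZero K → (μ : Partition n) (S : Box μ → ℕ) → Semistandard μ S →
              (T : SYT μ) → ¬ (F μ T S ≈ₚ 0ₚ)
  F-nonzero char0 μ S sst T F≈0
    with monomial μ T S | monomial-isMonomial μ T S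
  ... | _ | r , α , refl , r≈1 , α≗ =
    nonzero id∈ε id-fixes (char0 k (≈-trans (≈-sym count) (F≈0 α)))
    where
    stable-sign : ∀ {s π} → (s , π) ∈ ε μ T → Fixes π α → s ≈ 1#
    stable-sign s,π∈ε fixes
      with ∈-cartesianProductWith⁻ _ (colGroup μ T) (rowGroup μ T) s,π∈ε
    ... | τ , σ , τ∈ , σ∈ , refl = sign-identity τ
      (column-part-trivial (row μ ∘ boxOf μ T) (col μ ∘ boxOf μ T) (S ∘ boxOf μ T)
        (λ {x} {y} same-row same-col → boxOf-injective μ T
          (box-≡ μ {boxOf μ T x} {boxOf μ T y} same-row same-col))
        (λ {x} {y} → Semistandard.col-strict sst (boxOf μ T x) (boxOf μ T y))
        σ τ
        (λ x → sym (rowGroup-stays μ T σ∈ x))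
        (λ x → sym (colGroup-stays μ T τ∈ x))
        same)
      where
      -- Compare the exponents of x_j in τσ x^α and in x^α for j = τ x.
      same : ∀ x → S (boxOf μ T (σ ⟨$⟩ˡ x)) ≡ S (boxOf μ T (τ ⟨$⟩ʳ x))
      same x = begin
        S (boxOf μ T (σ ⟨$⟩ˡ x))                    ≡⟨ sym (α≗ _) ⟩
        Vec.lookup α (σ ⟨$⟩ˡ x)                     ≡⟨ cong (λ y → Vec.lookup α (σ ⟨$⟩ˡ y))
                                                            (sym (Perm.inverseˡ τ)) ⟩
        Vec.lookup α (σ ⟨$⟩ˡ (τ ⟨$⟩ˡ (τ ⟨$⟩ʳ x)))   ≡⟨ fixes (τ ⟨$⟩ʳ x) ⟩
        Vec.lookup α (τ ⟨$⟩ʳ x)                     ≡⟨ α≗ _ ⟩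
        S (boxOf μ T (τ ⟨$⟩ʳ x))                    ∎
        where open ≡-Reasoning

    counted = coeff-stable r≈1 (ε μ T) stable-sign
    k       = proj₁ counted
    count   = proj₁ (proj₂ counted)
    nonzero = proj₂ (proj₂ counted)

    ι    = proj₁ (identity-listed n)
    ι∈   = proj₁ (proj₂ (identity-listed n))
    ι-id = proj₂ (proj₂ (identity-listed n))

    id∈ε : (sign K ι , ι ∘ₚ ι) ∈ ε μ T
    id∈ε = ∈-cartesianProductWith⁺ _
      (∈-filter⁺ {P = InColGroup μ T} (inColGroup? μ T) ι∈ λ _ → identity-preserves μ T ι ι-id)
      (∈-filter⁺ {P = InRowGroup μ T} (inRowGroup? μ T) ι∈ λ _ → identity-preserves μ T ι ι-id)

    id-fixes : Fixes (ι ∘ₚ ι) α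
    id-fixes j = cong (Vec.lookup α)
      (trans (inverse-identity ι ι-id _) (inverse-identity ι ι-id j))

corollary1p14 : ∀ {c ℓ : Level} (K : CommutativeRing c ℓ) → CharacteristicZero K →
    (n : ℕ) (μ : Partition n) (S : Box μ → ℕ) → Semistandard μ S →
    let open Polynomials K n in
    ∀ (f : Poly) → B μ S f → ¬ (f ≈ₚ 0ₚ)
corollary1p14 K char0 n μ S sst f (T , f≈F) f≈0 =
  F-nonzero K n char0 μ S sst T λ β → ≈-trans (≈-sym (f≈F β)) (f≈0 β)
  where open CommutativeRing K using () renaming (sym to ≈-sym; trans to ≈-trans)
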